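{- Let $T$ be an Aronszajn tree and let $G$ be a sparse $T$-graph with the following property: for every $t \in T$ there is a finite set $S_t \subseteq \{s \in T : s < t\}$ such that every $t' > t$ has all its down-neighbours (in $G$) that lie below $t$ inside $S_t$. Then the ray inflation $G \sharp \mathbb{N}$ witnesses that $\mathrm{HC}(\aleph_1)$ fails: it has an end $\varepsilon$ of degree $\aleph_1$ such that no set of $\aleph_1$ pairwise disjoint rays in $\varepsilon$ admits a connected ray graph in $G\sharp\mathbb{N}$.
   Context: An order tree is a partial order $(T,\le)$ with a unique minimal element (the root) in which every set $\lceil t\rceil=\{t' : t' \le t\}$ is well-ordered. The height of $t$ is the order type of $\{t' : t'<t\}$; the $i$-th level $T^i$ is the set of points of height $i$; a branch is a maximal chain. $t$ is a successor of $t'$ (and $t'$ its predecessor) if $t'<t$ with nothing strictly between; a point with no predecessor is a limit. An Aronszajn tree is an order tree of cardinality $\aleph_1$ all of whose branches and levels are countable. A $T$-graph is a graph $G$ with $V(G)=T$ such that the endvertices of every edge are comparable in $T$ and, for every $t$, the set of neighbours of $t$ below $t$ (its down-neighbours) is cofinal in $\{s : s<t\}$. $G$ is sparse if for every $t$ the set of down-neighbours of $t$ has order type $\mathrm{cf}(\{s : s<t\})$; for trees of height at most $\omega_1$ this means a successor's unique down-neighbour is its predecessor and the down-neighbours of a non-root limit form a cofinal $\omega$-sequence below it. For such $G$ (with $T$ of height at most $\omega_1$), the ray inflation $G\sharp\mathbb{N}$ has vertex set $T\times\mathbb{N}$ and edges: $(t,n)(t,n+1)$ for all $t,n$; $(t,n)(t',n)$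 for all $n$ whenever $t$ is a successor with predecessor $t'$; and $(t,n)(t_n,n)$ for all $n$ whenever $t$ is a non-root limit with down-neighbours $t_0<t_1<t_2<\cdots$. A ray is a one-way infinite path; two rays are equivalent if joined by infinitely many disjoint paths; ends are equivalence classes; the degree of an end is the maximal cardinality of a set of disjoint rays in it. Given a set $\mathcal{R}$ of disjoint equivalent rays, a graph $H$ on $\mathcal{R}$ is a ray graph if there is a set $\mathcal{P}$ of independent paths (no inner vertex of one on another), each meeting $\bigcup\mathcal{R}$ exactly in its endvertices, such that for every edge $RS$ of $H$ there are infinitely many disjoint $R$--$S$ paths in $\mathcal{P}$. $\mathrm{HC}(\kappa)$ states that every end of degree $\kappa$ of every graph contains $\kappa$ disjoint rays admitting a connected ray graph. -}

module Defs where

open import Data.Fin using (Fin; zero; suc; inject₁; fromℕ)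
open import Data.List using (List)
open import Data.List.Membership.Propositional using () renaming (_∈_ to _∈ₗ_)
open import Data.Nat using (ℕ; zero; suc)
open import Data.Nat.Properties using (1+n≢n)
open import Data.Product using (Σ; _×_; _,_; proj₁; proj₂; ∃; ∃-syntax)
open import Data.Sum using (_⊎_)
open import Function.Bundles using (_⇔_; _↔_; _↣_; Equivalence)
open import Function.Definitions using (Injective)
open import Level using (0ℓ)
open import Relation.Binary.Construct.Closure.Symmetric using (SymClosure; fwd; bwd; symmetric)
open import Relation.Binary.Core using (Rel)
open import Relation.Binary.Definitions using (Symmetric)
open import Relation.Binary.PropositionalEquality using (_≡_; _≢_; refl; sym; cong)
open import Relation.Binary.Structures using (IsPartialOrder)
open import Relation.Nullary using (¬_)
open import Relation.Unary using (Pred; _∈_; _⊆_; U)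
import Relation.Binary.Construct.NonStrictToStrict as ToStrict

Countable : {A : Set} → Pred A 0ℓ → Set
Countable {A} P = Σ (A → ℕ) λ f → ∀ {x y} → x ∈ P → y ∈ P → f x ≡ f y → x ≡ y

module Order {A : Set} (_≤_ : Rel A 0ℓ) where

  open ToStrict _≡_ _≤_ public using (_<_)

  -- The strict down-set { s : s < t }.
  Below : A → Pred A 0ℓ
  Below t s = s < t

  -- The down-set ⌈ t ⌉.
  ⌈_⌉ : A → Pred A 0ℓ
  ⌈ t ⌉ s = s ≤ t

  Comparable : Rel A 0ℓ
  Comparable x y = (x ≤ y) ⊎ (y ≤ x)

  IsChain : Pred A 0ℓ → Set
  IsChain C = ∀ {x y} → x ∈ C → y ∈ C → Comparable x y

  IsBranch : Pred A 0ℓ → Set₁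
  IsBranch B = IsChain B × (∀ (C : Pred A 0ℓ) → IsChain C → B ⊆ C → C ⊆ B)

  IsWellOrdered : Pred A 0ℓ → Set₁
  IsWellOrdered D =
    IsChain D ×
    (∀ (P : Pred A 0ℓ) → P ⊆ D → ∃ P → ∃[ m ] (m ∈ P × (∀ {x} → x ∈ P → m ≤ x)))

  IsMinimal : A → Set
  IsMinimal m = ∀ {x} → x ≤ m → x ≡ m

  IsEmbedding : Pred A 0ℓ → Pred A 0ℓ → (A → A) → Set
  IsEmbedding D E f =
    (∀ {x} → x ∈ D → f x ∈ E) ×
    (∀ {x y} → x ∈ D → y ∈ D → (x ≤ y) ⇔ (f x ≤ f y))

  -- For well-ordered D and E: the order type of D is at most that of E.
  _≼_ : Pred A 0ℓ → Pred A 0ℓ → Set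
  D ≼ E = ∃[ f ] IsEmbedding D E f

  SameOrderType : Pred A 0ℓ → Pred A 0ℓ → Set
  SameOrderType D E =
    ∃[ f ] (IsEmbedding D E f × (∀ {y} → y ∈ E → ∃[ x ] (x ∈ D × f x ≡ y)))

  IsCofinalIn : Pred A 0ℓ → Pred A 0ℓ → Set
  IsCofinalIn C D = C ⊆ D × (∀ {d} → d ∈ D → ∃[ c ] (c ∈ C × d ≤ c))

  -- N has order type cf(D), where cf(D) is the least order type of a cofinal
  -- subset of the well-ordered set D.
  HasOrderTypeCf : Pred A 0ℓ → Pred A 0ℓ → Set₁
  HasOrderTypeCf N D =
    Σ (Pred A 0ℓ) λ C →
      IsCofinalIn C D ×
      (∀ (C′ : Pred A 0ℓ) → IsCofinalIn C′ D → C ≼ C′) ×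
      SameOrderType N C

  _IsPredecessorOf_ : Rel A 0ℓ
  s IsPredecessorOf t = s < t × ¬ (∃[ r ] (s < r × r < t))

  IsLimit : A → Set
  IsLimit t = ¬ (∃[ s ] (s IsPredecessorOf t))

-- ω₁ is the uncountable well-order all of whose proper initial segments are
-- countable.
record IsOmega₁ {W : Set} (_≤_ : Rel W 0ℓ) : Set₁ where
  open Order _≤_
  field
    isPartialOrder  : IsPartialOrder _≡_ _≤_
    isWellOrdered   : IsWellOrdered U
    uncountable     : ¬ Countable {W} U
    initialSegments : ∀ w → Countable (Below w)

HasCardinalityℵ₁ : Set → Set₁
HasCardinalityℵ₁ A = Σ Set λ W → Σ (Rel W 0ℓ) λ _≤_ → IsOmega₁ _≤_ × (W ↔ A)

record IsOrderTree {T : Set} (_≤_ : Rel T 0ℓ) : Set₁ where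
  open Order _≤_
  field
    isPartialOrder : IsPartialOrder _≡_ _≤_
    root           : T
    root-minimal   : IsMinimal root
    root-unique    : ∀ {m} → IsMinimal m → m ≡ root
    ⌈⌉-wellOrdered : ∀ t → IsWellOrdered ⌈ t ⌉

record IsAronszajnTree {T : Set} (_≤_ : Rel T 0ℓ) : Set₁ where
  open Order _≤_
  field
    isOrderTree       : IsOrderTree _≤_
    cardinality       : HasCardinalityℵ₁ T
    branchesCountable : ∀ (B : Pred T 0ℓ) → IsBranch B → Countable B
    -- Each nonempty level consists of the points having the same height as
    -- one of its members t.
    levelsCountable   : ∀ t → Countable (λ s → SameOrderType (Below s) (Below t))
  open IsOrderTree isOrderTree public

record Graph (V : Set) : Set₁ where
  field
    _~_      : Rel V 0ℓ
    ~-sym    : Symmetric _~_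
    ~-irrefl : ∀ {v} → ¬ (v ~ v)

module _ {V : Set} (G : Graph V) where
  open Graph G

  record Path : Set where
    field
      length    : ℕ
      vertex    : Fin (suc length) → V
      adjacent  : ∀ (i : Fin length) → vertex (inject₁ i) ~ vertex (suc i)
      injective : Injective _≡_ _≡_ vertex

    first last : Fin (suc length)
    first = zero
    last  = fromℕ length

    IsEndIndex : Pred (Fin (suc length)) 0ℓ
    IsEndIndex i = (i ≡ first) ⊎ (i ≡ last)

    vertices : Pred V 0ℓ
    vertices v = ∃[ i ] vertex i ≡ v

  -- A ray has a unique first vertex, so as a subgraph it determines its
  -- vertex sequence.
  record Ray : Set where
    field
      vertex    : ℕ → V
      adjacent  : ∀ n → vertex n ~ vertex (suc n)
      injective : Injective _≡_ _≡_ vertex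

    vertices : Pred V 0ℓ
    vertices v = ∃[ n ] vertex n ≡ v

  Connected : Set
  Connected = ∀ u v → ∃[ p ] let open Path p in (vertex first ≡ u × vertex last ≡ v)

module _ {V : Set} {G : Graph V} where

  Disjoint : Pred V 0ℓ → Pred V 0ℓ → Set
  Disjoint A B = ∀ {v} → v ∈ A → ¬ (v ∈ B)

  IsPathFromTo : Pred V 0ℓ → Pred V 0ℓ → Path G → Set
  IsPathFromTo A B p =
    (∀ i → (vertex i ∈ A) ⇔ (i ≡ first)) × (∀ i → (vertex i ∈ B) ⇔ (i ≡ last))
    where open Path p

  -- An A–B path; as paths are undirected, either direction of traversal counts.
  IsPathBetween : Pred V 0ℓ → Pred V 0ℓ → Path G → Set
  IsPathBetween A B p = IsPathFromTo A B p ⊎ IsPathFromTo B A p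

  InfinitelyManyDisjointPaths : {K : Set} → (K → Path G) → Ray G → Ray G → Set
  InfinitelyManyDisjointPaths {K} P R S =
    Σ (ℕ → K) λ k →
      (∀ n → IsPathBetween (Ray.vertices R) (Ray.vertices S) (P (k n))) ×
      (∀ {m n} → m ≢ n → Disjoint (Path.vertices (P (k m))) (Path.vertices (P (k n))))

  Equivalent : Rel (Ray G) 0ℓ
  Equivalent R S = InfinitelyManyDisjointPaths (λ (p : Path G) → p) R S

  IsEnd : Pred (Ray G) 0ℓ → Set
  IsEnd ε = ∃[ R ] (∀ S → (S ∈ ε) ⇔ Equivalent R S)

  -- Sets of disjoint rays are families indexed by a type; disjointness of the
  -- rays makes such a family injective, so its cardinality is that of the
  -- index type.
  PairwiseDisjoint : {I : Set} → (I → Ray G) → Set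
  PairwiseDisjoint R = ∀ {i j} → i ≢ j → Disjoint (Ray.vertices (R i)) (Ray.vertices (R j))

  DisjointRaysIn : Pred (Ray G) 0ℓ → {I : Set} → (I → Ray G) → Set
  DisjointRaysIn ε R = PairwiseDisjoint R × (∀ i → R i ∈ ε)

  HasDegreeℵ₁ : Pred (Ray G) 0ℓ → Set₁
  HasDegreeℵ₁ ε =
    Σ Set λ I →
      HasCardinalityℵ₁ I ×
      (Σ (I → Ray G) λ R → DisjointRaysIn ε R) ×
      (∀ (J : Set) (S : J → Ray G) → DisjointRaysIn ε S → J ↣ I)

  Independent : {K : Set} → (K → Path G) → Set
  Independent {K} P =
    ∀ {k l : K} → k ≢ l → ∀ i → ¬ Path.IsEndIndex (P k) i →
      ¬ (Path.vertex (P k) i ∈ Path.vertices (P l))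

  IsRayGraph : {I : Set} → (I → Ray G) → Graph I → Set₁
  IsRayGraph {I} R H =
    Σ Set λ K → Σ (K → Path G) λ P →
      Independent P ×
      (∀ k i → (∃[ j ] Path.vertex (P k) i ∈ Ray.vertices (R j)) ⇔ Path.IsEndIndex (P k) i) ×
      (∀ {i j} → Graph._~_ H i j → InfinitelyManyDisjointPaths P (R i) (R j))

  AdmitsConnectedRayGraph : {I : Set} → (I → Ray G) → Set₁
  AdmitsConnectedRayGraph {I} R = Σ (Graph I) λ H → IsRayGraph R H × Connected H

module TGraph {T : Set} {_≤_ : Rel T 0ℓ} (tree : IsOrderTree _≤_) (G : Graph T) where
  open Order _≤_
  open IsOrderTree tree using (root)
  open Graph G

  DownNeighbours : T → Pred T 0ℓ
  DownNeighbours t s = s < t × s ~ t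

  IsTGraph : Set
  IsTGraph =
    (∀ {s t} → s ~ t → Comparable s t) ×
    (∀ t → IsCofinalIn (DownNeighbours t) (Below t))

  IsSparse : Set₁
  IsSparse = ∀ t → HasOrderTypeCf (DownNeighbours t) (Below t)

  HasFiniteTraces : Set
  HasFiniteTraces =
    ∀ t → Σ (List T) λ S →
      (∀ {s} → s ∈ₗ S → s < t) ×
      (∀ {t′} → t < t′ → ∀ {s} → s ∈ DownNeighbours t′ → s < t → s ∈ₗ S)

  EnumeratesDownNeighbours : T → (ℕ → T) → Set
  EnumeratesDownNeighbours t e =
    (∀ n → e n < e (suc n)) ×
    (∀ s → (s ∈ DownNeighbours t) ⇔ (∃[ n ] e n ≡ s))

  data InflationEdge : Rel (T × ℕ) 0ℓ where
    vertical  : ∀ {t n} → InflationEdge (t , n) (t , suc n)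
    successor : ∀ {t t′ n} → t′ IsPredecessorOf t → InflationEdge (t , n) (t′ , n)
    limit     : ∀ {t e n} → t ≢ root → IsLimit t → EnumeratesDownNeighbours t e →
                InflationEdge (t , n) (e n , n)

  private
    edge-irrefl : ∀ {x y} → InflationEdge x y → x ≢ y
    edge-irrefl vertical                           eq = 1+n≢n (sym (cong proj₂ eq))
    edge-irrefl (successor ((_ , t′≢t) , _))       eq = t′≢t (sym (cong proj₁ eq))
    edge-irrefl (limit {e = e} {n} _ _ (_ , enum)) eq =
      proj₂ (proj₁ (Equivalence.from (enum (e n)) (n , refl))) (sym (cong proj₁ eq))

    adjacent-irrefl : ∀ {x} → ¬ SymClosure InflationEdge x x
    adjacent-irrefl (fwd e) = edge-irrefl e refl
    adjacent-irrefl (bwd e) = edge-irrefl e refl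

  -- The ray inflation G ♯ ℕ.
  rayInflation : Graph (T × ℕ)
  rayInflation = record
    { _~_      = SymClosure InflationEdge
    ; ~-sym    = symmetric InflationEdge
    ; ~-irrefl = adjacent-irrefl
    }

{-# OPTIONS --safe #-}

-- Let ε be the end of the vertical rays {t} × ℕ: descending edges inside
-- T × {n} join (t , n) to (root , n), so all vertical rays are equivalent.
--
-- Let rank : T → ω₁ be the height.  Given ℵ₁ disjoint rays with a connected
-- ray graph H and paths P, choose ranks α₀, α₁, … with supremum αω such that
-- every ray, and every path through an inner vertex, that meets {rank ≤ αₙ}
-- stays in {rank < αₙ₊₁}.  Only countably many rays meet {rank < αω}, so H has
-- an edge ji with Rⱼ in {rank < α_N} and Rᵢ in {rank ≥ αω}.  All of Rᵢ lies
-- above one t of rank αω.  A path from Rᵢ to Rⱼ leaves the points above t at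
-- some vertex (s , n); by the choice of αω it is not an inner vertex, so it
-- lies on Rⱼ and s < t₀ for the t₀ < t of rank α_N.  Then s is in the finite
-- set S of traces below t₀ and n < |S|, since the first n + 1 down-neighbours
-- of the vertex preceding s all lie in S.  So only finitely many disjoint
-- paths are available.
--
-- Excluded middle is assumed for all types, not only propositions, and hence
-- produces witnesses: em⇒dne acts as a choice principle throughout.
module Submission where

open import Axiom.DoubleNegationElimination using (em⇒dne)
open import Axiom.ExcludedMiddle using (ExcludedMiddle)
open import Axiom.Extensionality.Propositional using (Extensionality; implicit-extensionality)
open import Data.Empty using (⊥; ⊥-elim)
open import Data.Fin as Fin using (Fin; zero; suc; inject₁; fromℕ; fromℕ<; toℕ; combine)
import Data.Fin.Properties as Fin
import Data.List as List
open import Data.List.Membership.Propositional using () renaming (_∈_ to _∈ₗ_)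
open import Data.List.Membership.Setoid.Properties using (index-injective)
import Data.List.Relation.Unary.Any as Any
open import Data.Nat as ℕ using (ℕ; zero; suc; _+_)
import Data.Nat.Induction as ℕ
import Data.Nat.Properties as ℕ
open import Data.Product using (Σ; _×_; _,_; proj₁; proj₂; ∃; ∃-syntax)
open import Data.Product.Relation.Binary.Lex.Strict using (×-Lex; ×-wellFounded)
open import Data.Sum using (_⊎_; inj₁; inj₂; [_,_]′; swap)
open import Function using (_∘_; id)
open import Function.Bundles using (_⇔_; _↔_; _↣_; mk⇔; mk↣; Equivalence; Inverse; Injection)
open import Function.Construct.Composition using (_↣-∘_)
open import Function.Definitions using (Injective)
open import Function.Properties.Inverse using (↔⇒↣; ↔-sym)
open import Induction.WellFounded using (Acc; acc; WfRec; WellFounded; module All; module FixPoint)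
open import Level using (0ℓ)
open import Relation.Binary.Construct.Closure.Symmetric using (fwd; bwd)
import Relation.Binary.Construct.On as On
open import Relation.Binary.Core using (Rel)
open import Relation.Binary.Definitions using (Trichotomous; Tri; tri<; tri≈; tri>)
open import Relation.Binary.PropositionalEquality using (_≡_; _≢_; refl; sym; trans; cong; cong₂; subst; setoid)
open import Relation.Binary.Structures using (IsPartialOrder)
open import Relation.Nullary using (¬_; Dec; yes; no)
open import Relation.Unary using (Pred; _∈_; _⊆_; U)
open import Defs

-- Pairing, countable sets and finite boxes.

pair : ℕ → ℕ → ℕ
pair zero    n = suc (n + n)
pair (suc m) n = pair m n + pair m n

double-injective : ∀ m n → m + m ≡ n + n → m ≡ n
double-injective zero    zero    _  = refl
double-injective (suc m) (suc n) eq
  rewrite ℕ.+-suc m m | ℕ.+-suc n n =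
  cong suc (double-injective m n (ℕ.suc-injective (ℕ.suc-injective eq)))

odd≢even : ∀ m n → suc (m + m) ≢ n + n
odd≢even zero    (suc n) eq rewrite ℕ.+-suc n n with () ← eq
odd≢even (suc m) (suc n) eq rewrite ℕ.+-suc m m | ℕ.+-suc n n =
  odd≢even m n (ℕ.suc-injective (ℕ.suc-injective eq))

-- `pair m n` is 2^m (2n + 1), so parity tells whether the first argument is `zero`, and halving
-- reduces it by one.
pair-injective : ∀ m {n} m′ {n′} → pair m n ≡ pair m′ n′ → m ≡ m′ × n ≡ n′
pair-injective zero    {n} zero     {n′} eq = refl , double-injective n n′ (ℕ.suc-injective eq)
pair-injective zero    {n} (suc m′) {n′} eq = ⊥-elim (odd≢even n (pair m′ n′) eq)
pair-injective (suc m) {n} zero     {n′} eq = ⊥-elim (odd≢even n′ (pair m n) (sym eq))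
pair-injective (suc m)     (suc m′)      eq
  with refl , n≡n′ ← pair-injective m m′ (double-injective _ _ eq) = refl , n≡n′

countable-×ℕ : {A : Set} {P : Pred A 0ℓ} → Countable P → Countable {A × ℕ} (λ x → proj₁ x ∈ P)
countable-×ℕ {A} {P} (f , f-injective) = (λ (a , n) → pair (f a) n) , injective
  where
  injective : {x y : A × ℕ} → proj₁ x ∈ P → proj₁ y ∈ P →
    pair (f (proj₁ x)) (proj₂ x) ≡ pair (f (proj₁ y)) (proj₂ y) → x ≡ y
  injective {a , m} {b , n} a∈P b∈P eq with fa≡fb , refl ← pair-injective (f a) (f b) eq =
    cong (_, m) (f-injective a∈P b∈P fa≡fb)

countable-⊆ : {A : Set} {P Q : Pred A 0ℓ} → Q ⊆ P → Countable P → Countable Q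
countable-⊆ Q⊆P (f , f-injective) = f , λ x∈Q y∈Q → f-injective (Q⊆P x∈Q) (Q⊆P y∈Q)

countable-pullback : {A B : Set} {P : Pred B 0ℓ} → Countable P →
  (g : A → B) → (∀ x → g x ∈ P) → Injective _≡_ _≡_ g → Countable {A} U
countable-pullback (f , f-injective) g g∈P g-injective =
  f ∘ g , λ _ _ eq → g-injective (f-injective (g∈P _) (g∈P _) eq)

ℵ₁-uncountable : {A : Set} → HasCardinalityℵ₁ A → ¬ Countable {A} U
ℵ₁-uncountable (_ , _ , ω₁ , W↔A) A-countable = IsOmega₁.uncountable ω₁
  (countable-pullback A-countable (Inverse.to W↔A) _ (Injection.injective (↔⇒↣ W↔A)))

no-injection-ℕ-Fin : ∀ {k} (f : ℕ → Fin k) → ¬ (∀ {m n} → m ≢ n → f m ≢ f n)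
no-injection-ℕ-Fin {k} f f-injective
  with i , j , i<j , eq ← Fin.pigeonhole (ℕ.n<1+n k) (f ∘ toℕ) =
  f-injective (ℕ.<⇒≢ i<j) eq

-- One list bounds both coordinates: for exits through limit edges, the ℕ-coordinate is the index of
-- the down-neighbour reached, hence at most the number of traces.
Box : {A : Set} → List.List A → Pred (A × ℕ) 0ℓ
Box xs (a , n) = a ∈ₗ xs × n ℕ.< List.length xs

boxIndex : {A : Set} {xs : List.List A} {v : A × ℕ} → v ∈ Box xs → Fin (List.length xs ℕ.* List.length xs)
boxIndex (a∈xs , n<k) = combine (Any.index a∈xs) (fromℕ< n<k)

boxIndex-injective : {A : Set} {xs : List.List A} {v w : A × ℕ} (p : v ∈ Box xs) (q : w ∈ Box xs) →
  boxIndex p ≡ boxIndex q → v ≡ w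
boxIndex-injective {A} (a∈xs , m<k) (b∈xs , n<k) eq
  with eq₁ , eq₂ ← Fin.combine-injective (Any.index a∈xs) _ (Any.index b∈xs) _ eq =
  cong₂ _,_ (index-injective (setoid A) a∈xs b∈xs eq₁) (Fin.fromℕ<-injective _ _ m<k n<k eq₂)

-- A discrete intermediate value argument, applied both to paths in the inflation and to a path in
-- the ray graph.
crossing : ∀ {k} (P : Pred (Fin (suc k)) 0ℓ) → (∀ i → Dec (i ∈ P)) →
  zero ∈ P → ¬ (fromℕ k ∈ P) → ∃[ i ] (inject₁ i ∈ P × ¬ (suc i ∈ P))
crossing {zero}  P P? p ¬p = ⊥-elim (¬p p)
crossing {suc k} P P? p ¬p with P? (suc zero)
... | no ¬q = zero , p , ¬q
... | yes q with i , r , ¬r ← crossing (P ∘ suc) (P? ∘ suc) q ¬p = suc i , r , ¬r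

×ℕ↣-resp-↔ : {A B : Set} → A ↔ B → (A × ℕ) ↣ A → (B × ℕ) ↣ B
×ℕ↣-resp-↔ A↔B f = mk↣ {to = λ (b , n) → Inverse.to A↔B (Injection.to f (Inverse.from A↔B b , n))}
  λ eq → let eq′ = Injection.injective f (Injection.injective (↔⇒↣ A↔B) eq)
         in cong₂ _,_ (Injection.injective (↔⇒↣ (↔-sym A↔B)) (cong proj₁ eq′)) (cong proj₂ eq′)

-- Strict orders and accessibility.

module PartialOrder {A : Set} {_≤_ : Rel A 0ℓ} (isPartialOrder : IsPartialOrder _≡_ _≤_) where
  open Order _≤_
  open IsPartialOrder isPartialOrder public
    using (antisym) renaming (refl to ≤-refl; trans to ≤-trans)

  ≤-<-trans : ∀ {x y z} → x ≤ y → y < z → x < z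
  ≤-<-trans x≤y (y≤z , y≢z) = ≤-trans x≤y y≤z , λ { refl → y≢z (antisym y≤z x≤y) }

  <-≤-trans : ∀ {x y z} → x < y → y ≤ z → x < z
  <-≤-trans (x≤y , x≢y) y≤z = ≤-trans x≤y y≤z , λ { refl → x≢y (antisym x≤y y≤z) }

  <-trans : ∀ {x y z} → x < y → y < z → x < z
  <-trans x<y y<z = ≤-<-trans (proj₁ x<y) y<z

  <-irrefl : ∀ {x} → ¬ (x < x)
  <-irrefl x<x = proj₂ x<x refl

  ≤⇒≯ : ∀ {x y} → x ≤ y → ¬ (y < x)
  ≤⇒≯ x≤y y<x = <-irrefl (≤-<-trans x≤y y<x)

  module _ (em : ∀ {ℓ} → ExcludedMiddle ℓ) where

    ≤⇒≡∨< : ∀ {x y} → x ≤ y → x ≡ y ⊎ x < y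
    ≤⇒≡∨< {x} {y} x≤y with em {P = x ≡ y}
    ... | yes x≡y = inj₁ x≡y
    ... | no  x≢y = inj₂ (x≤y , x≢y)

    comparable⇒tri : ∀ {x y} → Comparable x y → Tri (x < y) (x ≡ y) (y < x)
    comparable⇒tri (inj₁ x≤y) with ≤⇒≡∨< x≤y
    ... | inj₁ refl = tri≈ <-irrefl refl <-irrefl
    ... | inj₂ x<y  = tri< x<y (proj₂ x<y) (≤⇒≯ x≤y)
    comparable⇒tri (inj₂ y≤x) with ≤⇒≡∨< y≤x
    ... | inj₁ refl = tri≈ <-irrefl refl <-irrefl
    ... | inj₂ y<x  = tri> (≤⇒≯ y≤x) (λ { refl → <-irrefl y<x }) y<x

    -- A least inaccessible point of `⌈ x ⌉` would have only accessible points below it.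
    <-wellFounded : (∀ x → IsWellOrdered ⌈ x ⌉) → WellFounded _<_
    <-wellFounded ⌈⌉-wellOrdered x = em⇒dne em λ ¬acc →
      let m , (m≤x , ¬acc-m) , m-least =
            proj₂ (⌈⌉-wellOrdered x) (λ y → y ≤ x × ¬ Acc _<_ y) proj₁ (x , ≤-refl , ¬acc)
      in ¬acc-m (acc λ {y} y<m → em⇒dne em λ ¬acc-y →
           ≤⇒≯ (m-least (≤-trans (proj₁ y<m) m≤x , ¬acc-y)) y<m)

-- Well-founded constructions: extending chains to branches, and successive choices.

module ChainExtension
  {A : Set} {_≤_ : Rel A 0ℓ} (isPartialOrder : IsPartialOrder _≡_ _≤_)
  {_⊏_ : Rel A 0ℓ} (⊏-wellFounded : WellFounded _⊏_) (⊏-compare : Trichotomous _≡_ _⊏_)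
  where
  open Order _≤_
  open PartialOrder isPartialOrder

  module _ (D : Pred A 0ℓ) where

    -- Run through A along ⊏ and keep every point comparable with D and with
    -- all points kept so far.
    Kept : ∀ x → Acc _⊏_ x → Set
    Kept x (acc rs) =
      (∀ {d} → d ∈ D → Comparable x d) ×
      (∀ {y} (y⊏x : y ⊏ x) → Kept y (rs y⊏x) → Comparable x y)

    -- `Kept` occurs negatively in its own recursion, so the recursive call transports in the
    -- opposite direction.
    Kept-irrelevant : ∀ {x} (p q : Acc _⊏_ x) → Kept x p → Kept x q
    Kept-irrelevant (acc rs) (acc rs′) (toD , toKept) =
      toD , λ y⊏x k → toKept y⊏x (Kept-irrelevant (rs′ y⊏x) (rs y⊏x) k)

    Extension : Pred A 0ℓ
    Extension x = Kept x (⊏-wellFounded x)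

    extension-D : ∀ {x d} → x ∈ Extension → d ∈ D → Comparable x d
    extension-D {x} k with acc rs ← ⊏-wellFounded x = proj₁ k

    extension-⊏ : ∀ {x y} → x ∈ Extension → y ∈ Extension → y ⊏ x → Comparable x y
    extension-⊏ {x} {y} k l y⊏x with acc rs ← ⊏-wellFounded x =
      proj₂ k y⊏x (Kept-irrelevant (⊏-wellFounded y) (rs y⊏x) l)

    extension-intro : ∀ {x} → (∀ {d} → d ∈ D → Comparable x d) →
      (∀ {y} → y ∈ Extension → Comparable x y) → x ∈ Extension
    extension-intro {x} toD toE with acc rs ← ⊏-wellFounded x =
      toD , λ {y} y⊏x k → toE (Kept-irrelevant (rs y⊏x) (⊏-wellFounded y) k)

    extension-chain : IsChain Extension
    extension-chain {x} {y} k l with ⊏-compare x y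
    ... | tri< x⊏y _ _ = swap (extension-⊏ l k x⊏y)
    ... | tri≈ _ refl _ = inj₁ ≤-refl
    ... | tri> _ _ y⊏x = extension-⊏ k l y⊏x

    D⊆extension : IsChain D → D ⊆ Extension
    D⊆extension D-chain d∈D = extension-intro (D-chain d∈D) (λ k → swap (extension-D k d∈D))

    -- A point of a larger chain is comparable with `D` and with everything kept, so it was itself
    -- kept. With a well-order at hand this replaces Zorn's lemma.
    extension-branch : IsChain D → IsBranch Extension
    extension-branch D-chain = extension-chain , λ C C-chain E⊆C c∈C →
      extension-intro (λ d∈D → C-chain c∈C (E⊆C (D⊆extension D-chain d∈D)))
                      (λ e∈E → C-chain c∈C (E⊆C e∈E))

-- Good takes a total function, and not values indexed by proofs of y < x,
-- because < is proof-relevant: there may be uncountably many such proofs.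
module WellFoundedChoice
  (em : ∀ {ℓ} → ExcludedMiddle ℓ) (ext : ∀ {a b} → Extensionality a b)
  {A B : Set} {_<_ : Rel A 0ℓ} (<-wf : WellFounded _<_) (default : B)
  (Good : A → (A → B) → Pred B 0ℓ)
  (Good-local : ∀ {x f g b} → (∀ {y} → y < x → f y ≡ g y) → b ∈ Good x f → b ∈ Good x g)
  (choose : ∀ x f → ∃[ b ] b ∈ Good x f)
  where

  private
    totalise : ∀ x → WfRec _<_ (λ _ → B) x → A → B
    totalise x previous y with em {P = y < x}
    ... | yes y<x = previous y<x
    -- Any value would do here: by `Good-local` only the values below `x` matter.
    ... | no  _   = default

    totalise-< : ∀ {x} (f : A → B) {y} → y < x → totalise x (λ {z} _ → f z) y ≡ f y
    totalise-< {x} f {y} y<x with em {P = y < x}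
    ... | yes _   = refl
    ... | no  y≮x = ⊥-elim (y≮x y<x)

    step : ∀ x → WfRec _<_ (λ _ → B) x → B
    step x previous = proj₁ (choose x (totalise x previous))

    -- `choose` need not respect pointwise equality of its function argument; extensionality turns
    -- that into equality, so that the recursion can be unfolded.
    step-ext : ∀ x {p q : WfRec _<_ (λ _ → B) x} →
      (∀ {y} y<x → p {y} y<x ≡ q y<x) → step x p ≡ step x q
    step-ext x p≡q = cong (λ (r : WfRec _<_ (λ _ → B) x) → step x r)
      (implicit-extensionality ext (ext p≡q))

  opaque
    function : A → B
    function = All.wfRec <-wf 0ℓ (λ _ → B) step

    function-good : ∀ x → function x ∈ Good x function
    function-good x = Good-local (totalise-< function) (subst (_∈ Good x (totalise x (λ {y} _ → function y)))
      (sym (FixPoint.unfold-wfRec <-wf (λ _ → B) step step-ext))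
      (proj₂ (choose x (totalise x (λ {y} _ → function y)))))

-- Regularity of ω₁ and ℵ₁ · ℵ₀ = ℵ₁.

module Omega₁ (em : ∀ {ℓ} → ExcludedMiddle ℓ) {W : Set} {_≤_ : Rel W 0ℓ} (ω₁ : IsOmega₁ _≤_) where
  open IsOmega₁ ω₁
  open Order _≤_
  open PartialOrder isPartialOrder public

  compare : Trichotomous _≡_ _<_
  compare x y = comparable⇒tri em (proj₁ isWellOrdered _ _)

  ≮⇒≥ : ∀ {x y} → ¬ (x < y) → y ≤ x
  ≮⇒≥ {x} {y} x≮y with compare x y
  ... | tri< x<y _ _ = ⊥-elim (x≮y x<y)
  ... | tri≈ _ refl _ = ≤-refl
  ... | tri> _ _ y<x = proj₁ y<x

  ≰⇒> : ∀ {x y} → ¬ (x ≤ y) → y < x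
  ≰⇒> {x} {y} x≰y with compare x y
  ... | tri< x<y _ _ = ⊥-elim (x≰y (proj₁ x<y))
  ... | tri≈ _ refl _ = ⊥-elim (x≰y ≤-refl)
  ... | tri> _ _ y<x = y<x

  least : (P : Pred W 0ℓ) → ∃ P → ∃[ m ] (m ∈ P × (∀ {x} → x ∈ P → m ≤ x))
  least P = proj₂ isWellOrdered P _

  ω₁-wellFounded : WellFounded _<_
  ω₁-wellFounded = <-wellFounded em λ x →
    (λ _ _ → proj₁ isWellOrdered _ _) , λ P _ → least P

  ⌈⌉-countable : ∀ w → Countable ⌈ w ⌉
  ⌈⌉-countable w = code , injective
    where
    f : W → ℕ
    f = proj₁ (initialSegments w)
    code : W → ℕ
    code v with em {P = v ≡ w}
    ... | yes _ = 0
    ... | no  _ = suc (f v)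
    injective : ∀ {x y} → x ≤ w → y ≤ w → code x ≡ code y → x ≡ y
    injective {x} {y} x≤w y≤w eq with em {P = x ≡ w} | em {P = y ≡ w}
    -- The mixed cases would equate 0 with a successor.
    ... | yes x≡w | yes y≡w = trans x≡w (sym y≡w)
    ... | no  x≢w | no  y≢w =
      proj₂ (initialSegments w) (x≤w , x≢w) (y≤w , y≢w) (ℕ.suc-injective eq)

  opaque
    -- Regularity of ω₁: were the values unbounded, ω₁ would be a countable union of the countable
    -- initial segments `⌈ g x ⌉`.
    countable-bounded : {A : Set} {P : Pred A 0ℓ} → Countable P → (g : A → W) →
      ∃[ w ] (∀ {x} → x ∈ P → g x < w)
    countable-bounded {A} {P} (f , f-injective) g = em⇒dne em λ unbounded →
      let above : ∀ w → ∃[ x ] (x ∈ P × w ≤ g x)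
          above w = em⇒dne em λ none → unbounded (w , λ {x} x∈P →
            ≰⇒> (λ w≤gx → none (x , x∈P , w≤gx)))
      in uncountable (union-countable above)
      where
      union-countable : (∀ w → ∃[ x ] (x ∈ P × w ≤ g x)) → Countable {W} U
      union-countable above = code , λ _ _ → injective
        where
        code : W → ℕ
        code w = let x , _ = above w in pair (f x) (proj₁ (⌈⌉-countable (g x)) w)
        injective : ∀ {v w} → code v ≡ code w → v ≡ w
        injective {v} {w} eq with above v | above w
        ... | x , x∈P , v≤gx | y , y∈P , w≤gy
          with fx≡fy , eq′ ← pair-injective (f x) (f y) eq
          with refl ← f-injective x∈P y∈P fx≡fy = proj₂ (⌈⌉-countable (g x)) v≤gx w≤gy eq′

  -- Obtained as a bound of the empty family.
  inhabited : W
  inhabited = proj₁ (countable-bounded {A = ⊥} {P = U} ((λ ()) , λ { {()} }) λ ())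

  sequence-bounded : (g : ℕ → W) → ∃[ w ] (∀ n → g n < w)
  sequence-bounded g with w , g<w ← countable-bounded {P = U} (id , λ _ _ eq → eq) g =
    w , λ n → g<w {n} _

  -- Values are chosen along the lexicographic well-order. The predecessors of a pair form a
  -- countable set, so a strict bound of the earlier values exists and is a new value.
  ω₁×ℕ↣ω₁ : (∀ {a b} → Extensionality a b) → (W × ℕ) ↣ W
  ω₁×ℕ↣ω₁ ext = mk↣ injective
    where
    _≺_ : Rel (W × ℕ) 0ℓ
    _≺_ = ×-Lex _≡_ _<_ ℕ._<_

    ≺⇒≤ : ∀ {x y} → x ≺ y → proj₁ x ≤ proj₁ y
    ≺⇒≤ (inj₁ v<w)        = proj₁ v<w
    ≺⇒≤ (inj₂ (refl , _)) = ≤-refl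

    ≺-connex : ∀ {x y} → x ≢ y → x ≺ y ⊎ y ≺ x
    ≺-connex {v , m} {w , n} x≢y with compare v w | ℕ.<-cmp m n
    ... | tri< v<w _ _  | _             = inj₁ (inj₁ v<w)
    ... | tri> _ _ w<v  | _             = inj₂ (inj₁ w<v)
    ... | tri≈ _ refl _ | tri< m<n _ _  = inj₁ (inj₂ (refl , m<n))
    ... | tri≈ _ refl _ | tri≈ _ refl _ = ⊥-elim (x≢y refl)
    ... | tri≈ _ refl _ | tri> _ _ n<m  = inj₂ (inj₂ (refl , n<m))

    New : W × ℕ → (W × ℕ → W) → Pred W 0ℓ
    New x f w = ∀ {y} → y ≺ x → f y ≢ w

    new : ∀ x f → ∃[ w ] w ∈ New x f
    new x f with w , bound ← countable-bounded (countable-×ℕ (⌈⌉-countable (proj₁ x))) f =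
      w , λ y≺x → proj₂ (bound (≺⇒≤ y≺x))

    open WellFoundedChoice em ext (×-wellFounded ω₁-wellFounded ℕ.<-wellFounded)
      inhabited New
      (λ f≡g new-f y≺x gy≡w → new-f y≺x (trans (f≡g y≺x) gy≡w)) new

    injective : Injective _≡_ _≡_ function
    injective {x} {y} eq = em⇒dne em λ x≢y → [ (λ x≺y → function-good y x≺y eq)
      , (λ y≺x → function-good x y≺x (sym eq)) ]′ (≺-connex x≢y)

-- Heights in an Aronszajn tree as elements of ω₁.

module AronszajnTree
  (em : ∀ {ℓ} → ExcludedMiddle ℓ) (ext : ∀ {a b} → Extensionality a b)
  {T : Set} {_≤_ : Rel T 0ℓ} (aronszajn : IsAronszajnTree _≤_) where

  open IsAronszajnTree aronszajn
  open Order _≤_ public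
  open PartialOrder isPartialOrder public

  private
    ω₁ = proj₁ (proj₂ (proj₂ cardinality))
    W↔T = proj₂ (proj₂ (proj₂ cardinality))

  W : Set
  W = proj₁ cardinality

  _⊑_ : Rel W 0ℓ
  _⊑_ = proj₁ (proj₂ cardinality)

  open Order _⊑_ public using () renaming (_<_ to _⊏_)
  module W = Omega₁ em ω₁

  from-injective : Injective _≡_ _≡_ (Inverse.from W↔T)
  from-injective = Injection.injective (↔⇒↣ (↔-sym W↔T))

  opaque
    T×ℕ↣T : (T × ℕ) ↣ T
    T×ℕ↣T = ×ℕ↣-resp-↔ W↔T (W.ω₁×ℕ↣ω₁ ext)

  tree-wellFounded : WellFounded _<_
  tree-wellFounded = <-wellFounded em ⌈⌉-wellOrdered

  ⌈⌉-chain : ∀ {r s t} → r ≤ t → s ≤ t → Comparable r s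
  ⌈⌉-chain {t = t} = proj₁ (⌈⌉-wellOrdered t)

  root≤ : ∀ t → root ≤ t
  root≤ t with m , m≤t , m-least ← proj₂ (⌈⌉-wellOrdered t) ⌈ t ⌉ id (t , ≤-refl) =
    subst (_≤ t) (root-unique λ x≤m → antisym x≤m (m-least (≤-trans x≤m m≤t))) m≤t

  opaque
    -- Countability is assumed for branches only, so the chain `⌈ t ⌉` is first extended to a
    -- branch.
    below-countable : ∀ t → Countable (Below t)
    below-countable t = countable-⊆ (λ s<t → D⊆extension ⌈ t ⌉ ⌈⌉-chain (proj₁ s<t))
      (branchesCountable (Extension ⌈ t ⌉) (extension-branch ⌈ t ⌉ ⌈⌉-chain))
      where
      from : T → W
      from = Inverse.from W↔T

      compare : Trichotomous _≡_ (λ x y → from x ⊏ from y)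
      compare x y with W.compare (from x) (from y)
      ... | tri< lt ≢ ≯ = tri< lt (≢ ∘ cong from) ≯
      ... | tri> ≮ ≢ gt = tri> ≮ (≢ ∘ cong from) gt
      ... | tri≈ ≮ eq ≯ = tri≈ ≮ (from-injective eq) ≯

      open ChainExtension isPartialOrder (On.wellFounded from W.ω₁-wellFounded) compare

  private
    IsRank : T → (T → W) → Pred W 0ℓ
    IsRank t ρ w =
      (∀ {s} → s < t → ρ s ⊏ w) × (∀ {v} → (∀ {s} → s < t → ρ s ⊏ v) → w ⊑ v)

    -- Countably many points lie below `t`, so their ranks have a strict bound in ω₁, hence a least
    -- one.
    exists-rank : ∀ t ρ → ∃[ w ] w ∈ IsRank t ρ
    exists-rank t ρ
      with w , above , w-least ← W.least (λ v → ∀ {s} → s < t → ρ s ⊏ v)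
             (W.countable-bounded (below-countable t) ρ) =
      w , above , λ {v} → w-least {v}

    IsRank-local : ∀ {t ρ σ w} → (∀ {s} → s < t → ρ s ≡ σ s) → w ∈ IsRank t ρ → w ∈ IsRank t σ
    IsRank-local {w = w} ρ≡σ (above , least) =
      (λ s<t → subst (_⊏ w) (ρ≡σ s<t) (above s<t)) ,
      λ {v} bound → least (λ s<t → subst (_⊏ v) (sym (ρ≡σ s<t)) (bound s<t))

    module Rank = WellFoundedChoice em ext tree-wellFounded W.inhabited IsRank IsRank-local exists-rank

  opaque
    rank : T → W
    rank = Rank.function

    rank-< : ∀ {s t} → s < t → rank s ⊏ rank t
    rank-< {t = t} = proj₁ (Rank.function-good t)

    rank-least : ∀ {t v} → (∀ {s} → s < t → rank s ⊏ v) → rank t ⊑ v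
    rank-least {t} = proj₂ (Rank.function-good t)

  rank-≤ : ∀ {s t} → s ≤ t → rank s ⊑ rank t
  rank-≤ s≤t with ≤⇒≡∨< em s≤t
  ... | inj₁ refl = W.≤-refl
  ... | inj₂ s<t  = proj₁ (rank-< s<t)

  rank-reflects-≤ : ∀ {s t} → Comparable s t → rank s ⊑ rank t → s ≤ t
  rank-reflects-≤ (inj₁ s≤t) _ = s≤t
  rank-reflects-≤ (inj₂ t≤s) ρs⊑ρt with ≤⇒≡∨< em t≤s
  ... | inj₁ refl = ≤-refl
  ... | inj₂ t<s  = ⊥-elim (W.≤⇒≯ ρs⊑ρt (rank-< t<s))

  rank-reflects-< : ∀ {s t} → Comparable s t → rank s ⊏ rank t → s < t
  rank-reflects-< c ρs⊏ρt = rank-reflects-≤ c (proj₁ ρs⊏ρt) , λ { refl → W.<-irrefl ρs⊏ρt }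

  rank-injective : ∀ {s t} → Comparable s t → rank s ≡ rank t → s ≡ t
  rank-injective {s} {t} c eq = antisym
    (rank-reflects-≤ c (subst (rank s ⊑_) eq W.≤-refl))
    (rank-reflects-≤ (swap c) (subst (_⊑ rank s) eq W.≤-refl))

  -- Since `rank t` is a least strict bound, some `s < t` has rank at least `w`; if the rank is
  -- larger, the search continues below `s`.
  rank-attains : ∀ {t w} → w ⊏ rank t → ∃[ s ] (s < t × rank s ≡ w)
  rank-attains {t} = attains (tree-wellFounded t)
    where
    attains : ∀ {t w} → Acc _<_ t → w ⊏ rank t → ∃[ s ] (s < t × rank s ≡ w)
    attains {t} {w} (acc rs) w⊏ρt = attain (em⇒dne em λ none →
      W.≤⇒≯ (rank-least λ {s} s<t →
        W.≰⇒> (λ w⊑ρs → none (s , s<t , w⊑ρs))) w⊏ρt)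
      where
      attain : ∃[ s ] (s < t × w ⊑ rank s) → ∃[ s ] (s < t × rank s ≡ w)
      attain (s , s<t , w⊑ρs) with W.≤⇒≡∨< em w⊑ρs
      ... | inj₁ w≡ρs = s , s<t , sym w≡ρs
      ... | inj₂ w⊏ρs with r , r<s , eq ← attains (rs s<t) w⊏ρs = r , <-trans r<s s<t , eq

  -- The isomorphism matches points of equal rank. It links ranks to levels, whose countability is
  -- stated through order types.
  sameRank⇒sameOrderType : ∀ {s t} → rank s ≡ rank t → SameOrderType (Below s) (Below t)
  sameRank⇒sameOrderType {s} {t} ρs≡ρt = f , (f-below , f-embedding) , f-onto
    where
    partner : ∀ x → ∃[ y ] (x < s → y < t × rank y ≡ rank x)
    partner x with em {P = x < s}
    -- An arbitrary value, since an embedding is given by a total map.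
    ... | no  x≮s = x , λ x<s → ⊥-elim (x≮s x<s)
    ... | yes x<s with y , y<t , eq ← rank-attains (subst (rank x ⊏_) ρs≡ρt (rank-< x<s)) =
      y , λ _ → y<t , eq

    f : T → T
    f x = proj₁ (partner x)

    f-below : ∀ {x} → x < s → f x < t
    f-below {x} x<s = proj₁ (proj₂ (partner x) x<s)

    f-rank : ∀ {x} → x < s → rank (f x) ≡ rank x
    f-rank {x} x<s = proj₂ (proj₂ (partner x) x<s)

    f-embedding : ∀ {x y} → x < s → y < s → (x ≤ y) ⇔ (f x ≤ f y)
    f-embedding {x} {y} x<s y<s = mk⇔
      (λ x≤y → rank-reflects-≤ (⌈⌉-chain (proj₁ (f-below x<s)) (proj₁ (f-below y<s)))
        (subst (_⊑ _) (sym (f-rank x<s)) (subst (_ ⊑_) (sym (f-rank y<s)) (rank-≤ x≤y))))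
      (λ fx≤fy → rank-reflects-≤ (⌈⌉-chain (proj₁ x<s) (proj₁ y<s))
        (subst (_⊑ _) (f-rank x<s) (subst (_ ⊑_) (f-rank y<s) (rank-≤ fx≤fy))))

    f-onto : ∀ {y} → y < t → ∃[ x ] (x < s × f x ≡ y)
    f-onto {y} y<t
      with x , x<s , eq ← rank-attains (subst (rank y ⊏_) (sym ρs≡ρt) (rank-< y<t)) =
      x , x<s , rank-injective (⌈⌉-chain (proj₁ (f-below x<s)) (proj₁ y<t))
        (trans (f-rank x<s) eq)

  -- A countable union of countable levels: the code pairs the rank with the position inside the
  -- level.
  rank⊑-countable : ∀ w → Countable (λ t → rank t ⊑ w)
  rank⊑-countable w = code , injective
    where
    levelCode : ∀ v → Countable (λ t → rank t ≡ v)
    levelCode v with em {P = ∃[ t ] rank t ≡ v}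
    ... | yes (t , refl) = countable-⊆ sameRank⇒sameOrderType (levelsCountable t)
    ... | no  none       = (λ _ → 0) , λ {x} ρx≡v → ⊥-elim (none (x , ρx≡v))

    code : T → ℕ
    code t = pair (proj₁ (W.⌈⌉-countable w) (rank t)) (proj₁ (levelCode (rank t)) t)

    injective : ∀ {s t} → rank s ⊑ w → rank t ⊑ w → code s ≡ code t → s ≡ t
    injective {s} {t} ρs⊑w ρt⊑w eq
      with eq₁ , eq₂ ← pair-injective (proj₁ (W.⌈⌉-countable w) (rank s)) _ eq
      with ρs≡ρt ← proj₂ (W.⌈⌉-countable w) ρs⊑w ρt⊑w eq₁ =
      proj₂ (levelCode (rank t)) ρs≡ρt refl
        (trans (cong (λ v → proj₁ (levelCode v) s) (sym ρs≡ρt)) eq₂)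

  rank-attains-⊑ : ∀ {t w} → w ⊑ rank t → ∃[ s ] (s ≤ t × rank s ≡ w)
  rank-attains-⊑ {t} w⊑ρt with W.≤⇒≡∨< em w⊑ρt
  ... | inj₁ w≡ρt = t , ≤-refl , sym w≡ρt
  ... | inj₂ w⊏ρt with s , s<t , eq ← rank-attains w⊏ρt = s , proj₁ s<t , eq

-- The ray inflation and its end of vertical rays.

module Inflation
  (em : ∀ {ℓ} → ExcludedMiddle ℓ) (ext : ∀ {a b} → Extensionality a b)
  {T : Set} {_≤_ : Rel T 0ℓ} (aronszajn : IsAronszajnTree _≤_) (G : Graph T) where

  open IsAronszajnTree aronszajn
  open AronszajnTree em ext aronszajn
  open TGraph isOrderTree G
  open Graph rayInflation using (_~_)

  -- Turns the abstract cofinality condition into an enumeration. `Below t` is countable without a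
  -- last element, so it has a cofinal ω-sequence; `N` embeds in that sequence and is unbounded, so
  -- it has order type ω.
  module LimitEnumeration (isTGraph : IsTGraph) (sparse : IsSparse)
    {t : T} (t≢root : t ≢ root) (t-limit : IsLimit t) where

    N : Pred T 0ℓ
    N = DownNeighbours t

    root<t : root < t
    root<t = root≤ t , t≢root ∘ sym

    between : ∀ {s} → s < t → ∃[ r ] (s < r × r < t)
    between s<t = em⇒dne em λ none → t-limit (_ , s<t , none)

    code = proj₁ (below-countable t)

    -- Overtaking the point coded `n` at stage `n` is what makes the climbing sequence cofinal.
    next : ∀ n {s} → s < t → ∃[ r ] (r < t × s < r × (∀ {x} → x < t → code x ≡ n → x ≤ r))
    next n {s} s<t with em {P = ∃[ x ] (x < t × code x ≡ n)}
    ... | no none with r , s<r , r<t ← between s<t =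
      r , r<t , s<r , λ {x} x<t eq → ⊥-elim (none (x , x<t , eq))
    ... | yes (x , x<t , x≡n) with ⌈⌉-chain (proj₁ s<t) (proj₁ x<t)
    ...   | inj₁ s≤x with r , x<r , r<t ← between x<t =
      r , r<t , ≤-<-trans s≤x x<r ,
      λ y<t y≡n → subst (_≤ r) (proj₂ (below-countable t) x<t y<t (trans x≡n (sym y≡n))) (proj₁ x<r)
    ...   | inj₂ x≤s with r , s<r , r<t ← between s<t =
      r , r<t , s<r ,
      λ y<t y≡n → subst (_≤ r) (proj₂ (below-countable t) x<t y<t (trans x≡n (sym y≡n)))
        (≤-trans x≤s (proj₁ s<r))

    climb : ℕ → ∃[ s ] s < t
    climb zero    = root , root<t
    climb (suc n) with r , r<t , _ ← next n (proj₂ (climb n)) = r , r<t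

    climb-step : ∀ n → proj₁ (climb n) < proj₁ (climb (suc n))
    climb-step n = proj₁ (proj₂ (proj₂ (next n (proj₂ (climb n)))))

    climb-mono : ∀ {m n} → m ℕ.≤′ n → proj₁ (climb m) ≤ proj₁ (climb n)
    climb-mono ℕ.≤′-refl          = ≤-refl
    climb-mono (ℕ.≤′-step {n} m≤n) = ≤-trans (climb-mono m≤n) (proj₁ (climb-step n))

    Climb : Pred T 0ℓ
    Climb s = ∃[ n ] proj₁ (climb n) ≡ s

    climb-cofinal : IsCofinalIn Climb (Below t)
    climb-cofinal = (λ { (n , refl) → proj₂ (climb n) }) , λ {x} x<t →
      _ , (suc (code x) , refl) , proj₂ (proj₂ (proj₂ (next (code x) (proj₂ (climb (code x)))))) x<t refl

    -- N embeds in every cofinal subset of Below t, so in particular in the ω-sequence Climb.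
    position : ∀ {s} → s ∈ N → ℕ
    position-< : ∀ {r s} (r∈N : r ∈ N) (s∈N : s ∈ N) → r < s → position r∈N ℕ.< position s∈N
    position s∈N with C , C-cofinal , C-least , h , (h∈C , _) , _ ← sparse t
      with g , g∈Climb , _ ← C-least Climb climb-cofinal = proj₁ (g∈Climb (h∈C s∈N))
    position-< r∈N s∈N r<s with C , C-cofinal , C-least , h , (h∈C , h-embedding) , _ ← sparse t
      with g , g∈Climb , g-embedding ← C-least Climb climb-cofinal =
      ℕ.≰⇒> λ ps≤pr → ≤⇒≯
        (Equivalence.from (h-embedding s∈N r∈N) (Equivalence.from (g-embedding (h∈C s∈N) (h∈C r∈N))
          (subst (_≤ _) (proj₂ (g∈Climb (h∈C s∈N))) (subst (_ ≤_) (proj₂ (g∈Climb (h∈C r∈N)))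
            (climb-mono (ℕ.≤⇒≤′ ps≤pr))))))
        r<s

    leastNeighbour : (P : Pred T 0ℓ) → ∃[ s ] (s ∈ N × s ∈ P) →
      ∃[ m ] ((m ∈ N × m ∈ P) × (∀ {s} → s ∈ N × s ∈ P → m ≤ s))
    leastNeighbour P = proj₂ (⌈⌉-wellOrdered t) (λ s → s ∈ N × s ∈ P) (λ p → proj₁ (proj₁ (proj₁ p)))

    neighbourAbove : ∀ {s} → s < t → ∃[ r ] (r ∈ N × s < r)
    neighbourAbove s<t with r , s<r , r<t ← between s<t
      with c , c∈N , r≤c ← proj₂ (proj₂ isTGraph t) r<t = c , c∈N , <-≤-trans s<r r≤c

    firstNeighbour : ∃[ m ] ((m ∈ N × m ∈ U) × (∀ {s} → s ∈ N × s ∈ U → m ≤ s))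
    firstNeighbour with r , r∈N , _ ← neighbourAbove root<t = leastNeighbour U (r , r∈N , _)

    nextNeighbour : ∀ {r} → r ∈ N → ∃[ m ] ((m ∈ N × r < m) × (∀ {s} → s ∈ N × r < s → m ≤ s))
    nextNeighbour {r} r∈N = leastNeighbour (r <_) (neighbourAbove (proj₁ r∈N))

    neighbour : ℕ → ∃[ s ] s ∈ N
    neighbour zero    with s , (s∈N , _) , _ ← firstNeighbour = s , s∈N
    neighbour (suc n) with s , (s∈N , _) , _ ← nextNeighbour (proj₂ (neighbour n)) = s , s∈N

    enumeration : ℕ → T
    enumeration = proj₁ ∘ neighbour

    enumeration-< : ∀ n → enumeration n < enumeration (suc n)
    enumeration-< n = proj₂ (proj₁ (proj₂ (nextNeighbour (proj₂ (neighbour n)))))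

    n≤position : ∀ n → n ℕ.≤ position (proj₂ (neighbour n))
    n≤position zero    = ℕ.z≤n
    n≤position (suc n) = ℕ.≤-<-trans (n≤position n)
      (position-< (proj₂ (neighbour n)) (proj₂ (neighbour (suc n))) (enumeration-< n))

    -- Each neighbour in the enumeration is the least one above the previous, so none is skipped.
    enumerated⊎above : ∀ {s} → s ∈ N → ∀ n → (∃[ m ] enumeration m ≡ s) ⊎ enumeration n < s
    enumerated⊎above s∈N zero with ≤⇒≡∨< em (proj₂ (proj₂ firstNeighbour) (s∈N , _))
    ... | inj₁ eq = inj₁ (0 , eq)
    ... | inj₂ lt = inj₂ lt
    enumerated⊎above s∈N (suc n) with enumerated⊎above s∈N n
    ... | inj₁ found = inj₁ found
    ... | inj₂ lt
      with ≤⇒≡∨< em (proj₂ (proj₂ (nextNeighbour (proj₂ (neighbour n)))) (s∈N , lt))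
    ...   | inj₁ eq  = inj₁ (suc n , eq)
    ...   | inj₂ lt′ = inj₂ lt′

    enumerates : EnumeratesDownNeighbours t enumeration
    enumerates = enumeration-< , λ s → mk⇔ onto λ { (n , refl) → proj₂ (neighbour n) }
      where
      onto : ∀ {s} → s ∈ N → ∃[ n ] enumeration n ≡ s
      -- If `s` were above the term with index `position s∈N`, that term would have a smaller
      -- position, against `n≤position`.
      onto s∈N with enumerated⊎above s∈N (position s∈N)
      ... | inj₁ found = found
      ... | inj₂ lt    = ⊥-elim (ℕ.≤⇒≯ (n≤position (position s∈N))
        (position-< (proj₂ (neighbour (position s∈N))) s∈N lt))

  -- A path inside T × {n}. The field `node-≤` ensures that a strictly higher starting point is new,
  -- which keeps extensions injective.
  record Descent (n : ℕ) (t : T) : Set where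
    field
      length     : ℕ
      node       : Fin (suc length) → T
      node-first : node zero ≡ t
      node-last  : node (fromℕ length) ≡ root
      node-≤     : ∀ i → node i ≤ t
      adjacent   : ∀ (i : Fin length) → (node (inject₁ i) , n) ~ (node (suc i) , n)
      injective  : Injective _≡_ _≡_ node

    path : Path rayInflation
    path = record
      { length    = length
      ; vertex    = λ i → node i , n
      ; adjacent  = adjacent
      ; injective = injective ∘ cong proj₁
      }

  vertical-ray : T → Ray rayInflation
  vertical-ray t = record
    { vertex    = t ,_
    ; adjacent  = λ _ → fwd vertical
    ; injective = cong proj₂
    }

  ε : Pred (Ray rayInflation) 0ℓ
  ε = Equivalent (vertical-ray root)

  vertical-disjoint : PairwiseDisjoint vertical-ray
  vertical-disjoint s≢t (_ , refl) (_ , eq) = s≢t (sym (cong proj₁ eq))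

  module _ (isTGraph : IsTGraph) (sparse : IsSparse) where

    downEdge : ∀ {t} n → t ≢ root → ∃[ s ] (s < t × InflationEdge (t , n) (s , n))
    downEdge {t} n t≢root with em {P = ∃[ s ] (s IsPredecessorOf t)}
    ... | yes (s , pred) = s , proj₁ pred , successor pred
    ... | no  t-limit    = enumeration n , proj₁ (proj₂ (neighbour n)) ,
                           limit t≢root t-limit enumerates
      where open LimitEnumeration isTGraph sparse t≢root t-limit

    descent : ∀ n t → Descent n t
    descent n t = descend (tree-wellFounded t)
      where
      trivial : Descent n root
      trivial = record
        { length     = 0
        ; node       = λ _ → root
        ; node-first = refl
        ; node-last  = refl
        ; node-≤     = λ _ → ≤-refl
        ; adjacent   = λ ()
        ; injective  = λ { {zero} {zero} _ → refl }
        }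

      extend : ∀ {s t} → s < t → InflationEdge (t , n) (s , n) → Descent n s → Descent n t
      extend {s} {t} s<t edge d = record
        { length     = suc D.length
        ; node       = node
        ; node-first = refl
        ; node-last  = D.node-last
        ; node-≤     = λ { zero → ≤-refl ; (suc i) → proj₁ (lower i) }
        ; adjacent   = λ { zero → subst (λ r → (t , n) ~ (r , n)) (sym D.node-first) (fwd edge)
                         ; (suc i) → D.adjacent i }
        ; injective  = injective
        }
        where
        module D = Descent d
        node : Fin (suc (suc D.length)) → T
        node zero    = t
        node (suc i) = D.node i
        lower : ∀ i → D.node i < t
        lower i = ≤-<-trans (D.node-≤ i) s<t
        injective : Injective _≡_ _≡_ node
        injective {zero}  {zero}  _  = refl
        injective {zero}  {suc j} eq = ⊥-elim (proj₂ (lower j) (sym eq))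
        injective {suc i} {zero}  eq = ⊥-elim (proj₂ (lower i) eq)
        injective {suc i} {suc j} eq = cong suc (D.injective eq)

      descend : ∀ {t} → Acc _<_ t → Descent n t
      descend {t} (acc rs) with em {P = t ≡ root}
      ... | yes refl   = trivial
      ... | no  t≢root with s , s<t , edge ← downEdge n t≢root = extend s<t edge (descend (rs s<t))

    -- The descents for different `n` lie in different layers T × {n}, hence are disjoint.
    vertical-equivalent : ∀ t → Equivalent (vertical-ray root) (vertical-ray t)
    vertical-equivalent t = (λ n → Descent.path (descent n t)) ,
      (λ n → inj₂ (meets (descent n t))) ,
      λ { m≢n (_ , refl) (_ , eq) → m≢n (sym (cong proj₂ eq)) }
      where
      meets : ∀ {n} (d : Descent n t) →
        IsPathFromTo (Ray.vertices (vertical-ray t)) (Ray.vertices (vertical-ray root)) (Descent.path d)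
      meets {n} d =
        (λ i → mk⇔ (λ (_ , eq) → D.injective (trans (sym (cong proj₁ eq)) (sym D.node-first)))
                   (λ { refl → n , cong (_, n) (sym D.node-first) })) ,
        (λ i → mk⇔ (λ (_ , eq) → D.injective (trans (sym (cong proj₁ eq)) (sym D.node-last)))
                   (λ { refl → n , cong (_, n) (sym D.node-last) }))
        where module D = Descent d

    -- The vertical rays give the lower bound. For the upper bound, disjoint rays have distinct
    -- first vertices, and T × ℕ injects into T.
    degreeℵ₁ : HasDegreeℵ₁ ε
    degreeℵ₁ = T , cardinality , (vertical-ray , vertical-disjoint , vertical-equivalent) ,
      λ J S (S-disjoint , _) → T×ℕ↣T ↣-∘ mk↣ {to = λ j → Ray.vertex (S j) 0} (λ {i} {j} eq →
        em⇒dne em λ i≢j → S-disjoint i≢j (0 , refl) (0 , sym eq))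

  -- Edges that jump over a tree point.

  edge-≥ : ∀ {x y} → InflationEdge x y → proj₁ y ≤ proj₁ x
  edge-≥ vertical                       = ≤-refl
  edge-≥ (successor pred)               = proj₁ (proj₁ pred)
  edge-≥ (limit {n = n} _ _ (_ , enum)) = proj₁ (proj₁ (Equivalence.from (enum _) (n , refl)))

  edge-comparable : ∀ {x y} → x ~ y → Comparable (proj₁ x) (proj₁ y)
  edge-comparable (fwd e) = inj₂ (edge-≥ e)
  edge-comparable (bwd e) = inj₁ (edge-≥ e)

  module _ (traces : HasFiniteTraces) where

    trace : T → List.List T
    trace t = proj₁ (traces t)

    -- The terms `e 0`, ..., `e n` are distinct and below `t`, so they occupy n + 1 different places
    -- of the trace.
    index-bounded : ∀ {t u} → t < u → ∀ {e} → EnumeratesDownNeighbours u e →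
      ∀ {n} → e n < t → n ℕ.< List.length (trace t)
    index-bounded {t} t<u {e} (e-step , enum) {n} en<t =
      Fin.injective⇒≤ {f = λ i → Any.index (e∈trace i)} λ {i} {j} eq →
        Fin.toℕ-injective (e-injective (index-injective (setoid T) (e∈trace i) (e∈trace j) eq))
      where
      e-mono : ∀ {m n} → m ℕ.≤′ n → e m ≤ e n
      e-mono ℕ.≤′-refl           = ≤-refl
      e-mono (ℕ.≤′-step {k} m≤k) = ≤-trans (e-mono m≤k) (proj₁ (e-step k))

      e-< : ∀ {m n} → m ℕ.< n → e m < e n
      e-< {m} m<n = <-≤-trans (e-step m) (e-mono (ℕ.≤⇒≤′ m<n))

      e-injective : ∀ {m n} → e m ≡ e n → m ≡ n
      e-injective {m} {n} eq with ℕ.<-cmp m n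
      ... | tri< m<n _ _ = ⊥-elim (proj₂ (e-< m<n) eq)
      ... | tri≈ _ m≡n _ = m≡n
      ... | tri> _ _ n<m = ⊥-elim (proj₂ (e-< n<m) (sym eq))

      e∈trace : (i : Fin (suc n)) → e (toℕ i) ∈ₗ trace t
      e∈trace i = proj₂ (proj₂ (traces t)) t<u (Equivalence.from (enum _) (toℕ i , refl))
        (≤-<-trans (e-mono (ℕ.≤⇒≤′ (ℕ.s≤s⁻¹ (Fin.toℕ<n i)))) en<t)

    -- Vertical edges keep the tree point and successor edges have nothing in between, so only a
    -- limit edge descending from `x` can jump over `t`.
    exit-in-trace : ∀ {t x y} → t < proj₁ x → proj₁ y < t → x ~ y → y ∈ Box (trace t)
    exit-in-trace t<x y<t (bwd e) = ⊥-elim (≤⇒≯ (edge-≥ e) (<-trans y<t t<x))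
    exit-in-trace t<x y<t (fwd vertical) = ⊥-elim (<-irrefl (<-trans y<t t<x))
    exit-in-trace t<x y<t (fwd (successor (_ , immediate))) = ⊥-elim (immediate (_ , y<t , t<x))
    exit-in-trace {t} t<x y<t (fwd (limit {n = n} _ _ enum)) =
      proj₂ (proj₂ (traces t)) t<x (Equivalence.from (proj₂ enum _) (n , refl)) y<t ,
      index-bounded t<x enum y<t

    -- Refuting a connected ray graph on ℵ₁ disjoint rays.

    module NoConnectedRayGraph {I : Set} (R : I → Ray rayInflation)
      (I-ℵ₁ : HasCardinalityℵ₁ I) (R-disjoint : PairwiseDisjoint R)
      {H : Graph I} {K : Set} (P : K → Path rayInflation) (P-independent : Independent P)
      (links : ∀ {i j} → Graph._~_ H i j → InfinitelyManyDisjointPaths P (R i) (R j))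
      (H-connected : Connected H)
      where

      rank₁ : T × ℕ → W
      rank₁ = rank ∘ proj₁

      rayRank : I → ℕ → W
      rayRank i m = rank₁ (Ray.vertex (R i) m)

      pathRank : ∀ k → Fin (suc (Path.length (P k))) → W
      pathRank k l = rank₁ (Path.vertex (P k) l)

      sameRay : ∀ {i j v} → v ∈ Ray.vertices (R i) → v ∈ Ray.vertices (R j) → i ≡ j
      sameRay v∈Ri v∈Rj = em⇒dne em λ i≢j → R-disjoint i≢j v∈Ri v∈Rj

      -- Bounds are attached to vertices, since only countably many have rank at most a given one.
      -- By disjointness a vertex lies on at most one ray.
      RayBound : T × ℕ → Pred W 0ℓ
      RayBound v w = ∀ i → v ∈ Ray.vertices (R i) → ∀ m → rayRank i m ⊏ w

      rayBound : ∀ v → ∃[ w ] w ∈ RayBound v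
      rayBound v with em {P = ∃[ i ] v ∈ Ray.vertices (R i)}
      ... | no  none       = W.inhabited , λ i v∈Ri → ⊥-elim (none (i , v∈Ri))
      ... | yes (j , v∈Rj) with w , bound ← W.sequence-bounded (rayRank j) =
        w , λ i v∈Ri m → subst (λ i → rayRank i m ⊏ w) (sameRay v∈Rj v∈Ri) (bound m)

      -- Independent paths may share ends, so only an inner vertex determines its path.
      InnerVertex : K → Pred (T × ℕ) 0ℓ
      InnerVertex k v = ∃[ l ] (¬ Path.IsEndIndex (P k) l × Path.vertex (P k) l ≡ v)

      PathBound : T × ℕ → Pred W 0ℓ
      PathBound v w = ∀ k → v ∈ InnerVertex k → ∀ l → pathRank k l ⊏ w

      pathBound : ∀ v → ∃[ w ] w ∈ PathBound v
      pathBound v with em {P = ∃[ k ] v ∈ InnerVertex k}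
      ... | no  none = W.inhabited , λ k inner → ⊥-elim (none (k , inner))
      ... | yes (k , l , inner , at-l)
        with w , bound ← W.countable-bounded {P = U} (toℕ , λ _ _ → Fin.toℕ-injective) (pathRank k) =
        w , λ { k′ (l′ , _ , at-l′) →
          subst (λ k → ∀ l → pathRank k l ⊏ w)
            (em⇒dne em λ k≢k′ → P-independent k≢k′ l inner (l′ , trans at-l′ (sym at-l)))
            (λ l → bound {l} _) }

      Closed : W → Pred W 0ℓ
      Closed w w′ = ∀ v → rank₁ v ⊑ w → w′ ∈ RayBound v × w′ ∈ PathBound v

      -- Only countably many vertices are concerned, so regularity of ω₁ bounds all their individual
      -- bounds at once.
      closure : ∀ w → ∃[ w′ ] w′ ∈ Closed w
      closure w
        with countable ← countable-×ℕ (rank⊑-countable w)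
        with a , rays<a ← W.countable-bounded countable (proj₁ ∘ rayBound)
        with b , paths<b ← W.countable-bounded countable (proj₁ ∘ pathBound)
        -- The two-valued sequence yields a common bound of `a` and `b`.
        with c , bound ← W.sequence-bounded (λ { 0 → a ; _ → b }) =
        c , λ v v⊑w →
          (λ i v∈Ri m → W.<-trans (proj₂ (rayBound v) i v∈Ri m) (W.<-trans (rays<a v⊑w) (bound 0))) ,
          (λ k inner l → W.<-trans (proj₂ (pathBound v) k inner l) (W.<-trans (paths<b v⊑w) (bound 1)))

      I-inhabited : I
      I-inhabited = em⇒dne em λ empty → ℵ₁-uncountable I-ℵ₁
        ((λ i → ⊥-elim (empty i)) , λ {i} → ⊥-elim (empty i))

      α : ℕ → W
      -- Starting at a vertex of a ray makes that ray low.
      α zero    = rayRank I-inhabited 0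
      α (suc n) = proj₁ (closure (α n))

      supremum : ∃[ w ] ((∀ n → α n ⊏ w) × (∀ {v} → (∀ n → α n ⊏ v) → w ⊑ v))
      supremum = W.least (λ w → ∀ n → α n ⊏ w) (W.sequence-bounded α)

      αω : W
      αω = proj₁ supremum

      α⊏αω : ∀ n → α n ⊏ αω
      α⊏αω = proj₁ (proj₂ supremum)

      below-αω : ∀ {w} → w ⊏ αω → ∃[ n ] w ⊑ α n
      below-αω w⊏αω = em⇒dne em λ none →
        W.≤⇒≯ (proj₂ (proj₂ supremum) λ n → W.≰⇒> λ w⊑αn → none (n , w⊑αn)) w⊏αω

      Low : Pred I 0ℓ
      Low i = ∃[ m ] rayRank i m ⊏ αω

      -- The ray has a vertex of rank at most some `α n`, and closure confines all of it below
      -- `α (suc n)`.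
      low-bounded : ∀ {i} → i ∈ Low → ∃[ n ] (∀ m → rayRank i m ⊏ α n)
      low-bounded {i} (m , low) with n , ρ⊑αn ← below-αω low =
        suc n , proj₁ (proj₂ (closure (α n)) _ ρ⊑αn) i (m , refl)

      -- Otherwise choosing a vertex of rank below `αω` on each ray would inject `I` into a
      -- countable set.
      exists-high : ∃[ i ] ¬ (i ∈ Low)
      exists-high = em⇒dne em λ none →
        let low : ∀ i → i ∈ Low
            low i = em⇒dne em λ high → none (i , high)
        in ℵ₁-uncountable I-ℵ₁ (countable-pullback (countable-×ℕ (rank⊑-countable αω))
             (λ i → Ray.vertex (R i) (proj₁ (low i))) (λ i → proj₁ (proj₂ (low i)))
             (λ {i} {j} eq → sameRay (proj₁ (low i) , refl) (proj₁ (low j) , sym eq)))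

      high-rank : ∀ {i} → ¬ (i ∈ Low) → ∀ m → αω ⊑ rayRank i m
      high-rank high m = W.≮⇒≥ λ low → high (m , low)

      -- Every linking path contains a vertex of one fixed finite box, and disjoint paths contain
      -- different ones.
      no-low-high-link : ∀ {j i} → j ∈ Low → ¬ (i ∈ Low) → ¬ InfinitelyManyDisjointPaths P (R j) (R i)
      no-low-high-link {j} {i} j-low i-high (k , joins , disjoint)
        with N , Rj⊏αN ← low-bounded j-low
        with t , t≤Ri0 , ρt≡αω ← rank-attains-⊑ (high-rank i-high 0)
        -- The trace is taken at `t₀`, because an exit may start at `t` itself, whose
        -- down-neighbours the trace of `t` does not control.
        with t₀ , t₀<t , ρt₀≡αN ← rank-attains (subst (α N ⊏_) (sym ρt≡αω) (α⊏αω N)) =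
        no-injection-ℕ-Fin (λ n → boxIndex (proj₂ (proj₂ (traced n)))) λ {m} {n′} m≢n′ eq →
          disjoint m≢n′ (proj₁ (proj₂ (traced m)))
            (subst (_∈ Path.vertices (P (k n′)))
              (sym (boxIndex-injective (proj₂ (proj₂ (traced m))) (proj₂ (proj₂ (traced n′))) eq))
              (proj₁ (proj₂ (traced n′))))
        where
        -- Edges join comparable points, and among the points below `x` rank decides the order, so a
        -- step down to rank at least `αω` cannot pass below `t`.
        stays-above : ∀ {x y} → x ~ y → t ≤ proj₁ x → αω ⊑ rank₁ y → t ≤ proj₁ y
        stays-above x~y t≤x αω⊑ρy with edge-comparable x~y
        ... | inj₁ x≤y = ≤-trans t≤x x≤y
        ... | inj₂ y≤x = rank-reflects-≤ (⌈⌉-chain t≤x y≤x) (subst (_⊑ _) (sym ρt≡αω) αω⊑ρy)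

        Ri-above : ∀ m → t ≤ proj₁ (Ray.vertex (R i) m)
        Ri-above zero    = t≤Ri0
        Ri-above (suc m) = stays-above (Ray.adjacent (R i) m) (Ri-above m) (high-rank i-high (suc m))

        Ri-above′ : ∀ {v} → v ∈ Ray.vertices (R i) → t ≤ proj₁ v
        Ri-above′ (m , refl) = Ri-above m

        Rj-not-above : ∀ {v} → v ∈ Ray.vertices (R j) → ¬ (t ≤ proj₁ v)
        Rj-not-above (m , refl) t≤v = W.≤⇒≯ (rank-≤ t≤v)
          (subst (_ ⊏_) (sym ρt≡αω) (W.<-trans (Rj⊏αN m) (α⊏αω N)))

        -- Oriented from the points above `t` outwards, whichever way the path is traversed.
        Exit : Path rayInflation → Set
        Exit p = ∃[ l ] ∃[ l′ ] (t ≤ proj₁ (Path.vertex p l) × ¬ (t ≤ proj₁ (Path.vertex p l′)) ×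
          Path.vertex p l ~ Path.vertex p l′)

        exit : ∀ p → IsPathBetween (Ray.vertices (R j)) (Ray.vertices (R i)) p → Exit p
        exit p (inj₁ (from-j , to-i))
          -- This path starts on `R j`, so the crossing found is an entry, read backwards.
          with l , ¬above , ¬¬above ← crossing (λ l → ¬ (t ≤ proj₁ (Path.vertex p l))) (λ _ → em)
                 (Rj-not-above (Equivalence.from (from-j (Path.first p)) refl))
                 (λ ¬above → ¬above (Ri-above′ (Equivalence.from (to-i (Path.last p)) refl))) =
          suc l , inject₁ l , em⇒dne em ¬¬above , ¬above ,
          Graph.~-sym rayInflation (Path.adjacent p l)
        exit p (inj₂ (from-i , to-j))
          with l , above , ¬above ← crossing (λ l → t ≤ proj₁ (Path.vertex p l)) (λ _ → em)
                 (Ri-above′ (Equivalence.from (from-i (Path.first p)) refl))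
                 (Rj-not-above (Equivalence.from (to-j (Path.last p)) refl)) =
          inject₁ l , suc l , above , ¬above , Path.adjacent p l

        end-on-Rj : ∀ p → IsPathBetween (Ray.vertices (R j)) (Ray.vertices (R i)) p →
          ∀ l → Path.IsEndIndex p l → ¬ (t ≤ proj₁ (Path.vertex p l)) →
          Path.vertex p l ∈ Ray.vertices (R j)
        end-on-Rj p (inj₁ (from-j , to-i)) l (inj₁ first) _ = Equivalence.from (from-j l) first
        end-on-Rj p (inj₁ (from-j , to-i)) l (inj₂ last) ¬above =
          ⊥-elim (¬above (Ri-above′ (Equivalence.from (to-i l) last)))
        end-on-Rj p (inj₂ (from-i , to-j)) l (inj₁ first) ¬above =
          ⊥-elim (¬above (Ri-above′ (Equivalence.from (from-i l) first)))
        end-on-Rj p (inj₂ (from-i , to-j)) l (inj₂ last) _ = Equivalence.from (to-j l) last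

        meets-Ri : ∀ p → IsPathBetween (Ray.vertices (R j)) (Ray.vertices (R i)) p →
          ∃[ l ] t ≤ proj₁ (Path.vertex p l)
        meets-Ri p between with l , _ , above , _ ← exit p between = l , above

        -- An exit vertex has rank below αω, so were it an inner vertex, its whole
        -- path would stay below αω.
        exit-on-Rj : ∀ n l′ → rank₁ (Path.vertex (P (k n)) l′) ⊏ αω →
          ¬ (t ≤ proj₁ (Path.vertex (P (k n)) l′)) →
          Path.vertex (P (k n)) l′ ∈ Ray.vertices (R j)
        exit-on-Rj n l′ ρ⊏αω ¬above with em {P = Path.IsEndIndex (P (k n)) l′}
        ... | yes end = end-on-Rj (P (k n)) (joins n) l′ end ¬above
        ... | no inner
          with m , ρ⊑αm ← below-αω ρ⊏αω
          with l , above ← meets-Ri (P (k n)) (joins n) = ⊥-elim (W.≤⇒≯ (rank-≤ above)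
            (subst (_ ⊏_) (sym ρt≡αω) (W.<-trans
              (proj₂ (proj₂ (closure (α m)) _ ρ⊑αm) (k n) (l′ , inner , refl) l) (α⊏αω (suc m)))))

        traced : ∀ n → ∃[ v ] (v ∈ Path.vertices (P (k n)) × v ∈ Box (trace t₀))
        traced n with l , l′ , above , ¬above , x~y ← exit (P (k n)) (joins n) =
          y , (l′ , refl) , exit-in-trace (<-≤-trans t₀<t above) y<t₀ x~y
          where
          y = Path.vertex (P (k n)) l′

          y<t : proj₁ y < t
          y<t with edge-comparable x~y
          ... | inj₁ x≤y = ⊥-elim (¬above (≤-trans above x≤y))
          ... | inj₂ y≤x with ⌈⌉-chain above y≤x
          ...   | inj₁ t≤y = ⊥-elim (¬above t≤y)
          ...   | inj₂ y≤t = y≤t , λ { refl → ¬above ≤-refl }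

          ρy⊏αN : rank₁ y ⊏ α N
          -- Lying on `R j` improves the bound on the rank of `y` from `αω` to `α N`, the rank of
          -- `t₀`.
          ρy⊏αN with m , eq ← exit-on-Rj n l′ (subst (_ ⊏_) ρt≡αω (rank-< y<t)) ¬above =
            subst (λ v → rank₁ v ⊏ α N) eq (Rj⊏αN m)

          y<t₀ : proj₁ y < t₀
          y<t₀ = rank-reflects-< (⌈⌉-chain (proj₁ y<t) (proj₁ t₀<t))
            (subst (rank₁ y ⊏_) (sym ρt₀≡αN) ρy⊏αN)

      contradiction : ⊥
      contradiction
        with i₁ , high ← exists-high
        with p , first≡i₀ , last≡i₁ ← H-connected I-inhabited i₁
        with l , low-l , high-l ← crossing (λ l → Path.vertex p l ∈ Low) (λ _ → em)
               (subst (_∈ Low) (sym first≡i₀) (0 , α⊏αω 0))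
               (λ low → high (subst (_∈ Low) last≡i₁ low)) =
        no-low-high-link low-l high-l (links (Path.adjacent p l))

theorem6p6 : (∀ {ℓ} → ExcludedMiddle ℓ) →
    (∀ {a b} → Extensionality a b) →
    (T : Set) (_≤_ : Rel T 0ℓ) (aronszajn : IsAronszajnTree _≤_) (G : Graph T) →
    let open TGraph (IsAronszajnTree.isOrderTree aronszajn) G in
    IsTGraph →
    IsSparse →
    HasFiniteTraces →
    Σ (Pred (Ray rayInflation) 0ℓ) λ ε →
    IsEnd ε ×
    HasDegreeℵ₁ ε ×
    (∀ (I : Set) (R : I → Ray rayInflation) → HasCardinalityℵ₁ I → DisjointRaysIn ε R → ¬ AdmitsConnectedRayGraph R)
theorem6p6 em ext T _≤_ aronszajn G isTGraph sparse traces =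
  ε ,
  (vertical-ray root , λ _ → mk⇔ id id) ,
  degreeℵ₁ isTGraph sparse ,
  λ { I R I-ℵ₁ (R-disjoint , _) (H , (K , P , P-independent , _ , links) , H-connected) →
    NoConnectedRayGraph.contradiction traces R I-ℵ₁ R-disjoint {H = H} P P-independent links H-connected }
  where
  open IsAronszajnTree aronszajn using (root)
  open Inflation em ext aronszajn G
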